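{- Let $\mathfrak{M}_E=(E,\mathrm{rk})$ be a matroid without loops, with $r=\mathrm{rk}(E)$ and $m=|E|$, and write its characteristic polynomial as \[ \chi(\mathfrak{M}_E;t)=a_0t^r-a_1t^{r-1}+a_2t^{r-2}+\cdots+(-1)^ra_r, \] with the convention $a_i=0$ for $i>r$. If $q,k\in\mathbb{Z}$ satisfy $0\le k\le q+r+1$, then \[ \binom{r+q}{k}\le \sum_{i=0}^{k}\binom{q}{k-i}a_{i}\le \binom{m+q}{k}. \] In particular, for $0\le k\le r$, \[ \binom{r-1}{k}\le (-1)^k\sum_{i=0}^{k}(-1)^ia_{i}\le \binom{m-1}{k} \] and \[ (-1)^k\sum_{i=0}^{k}\binom{r-i}{k-i}(-1)^ia_{i}\ge 0. \]
   Context: A matroid $\mathfrak{M}_E=(E,\mathrm{rk})$ is a finite list $E$ with a rank function $\mathrm{rk}:2^E\to\mathbb{Z}_{\ge0}$ such that $\mathrm{rk}(A)\le|A|$; $A\subseteq B$ implies $\mathrm{rk}(A)\le\mathrm{rk}(B)$; and $\mathrm{rk}(A\cup B)+\mathrm{rk}(A\cap B)\le\mathrm{rk}(A)+\mathrm{rk}(B)$. An element $v\in E$ is a loop if $\mathrm{rk}(\{v\})=0$. The characteristic polynomial is $\chi(\mathfrak{M}_E;t)=\sum_{A\subseteq E}(-1)^{|A|}t^{\mathrm{rk}(E)-\mathrm{rk}(A)}$. For $\alpha\in\mathbb{C}$ and $k\in\mathbb{Z}_{\ge0}$, $\binom{\alpha}{k}=\frac{1}{k!}\alpha(\alpha-1)\cdots(\alpha-k+1)$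 is the generalized binomial coefficient (so $\binom{\alpha}{0}=1$). -}

module Defs where

open import Data.Bool.Base using (if_then_else_)
open import Data.Fin.Base using (Fin)
open import Data.Fin.Subset using (Subset; inside; outside; ⊤; ⁅_⁆; _⊆_; _∪_; _∩_; ∣_∣)
open import Data.Integer.Base as ℤ using (ℤ; +_; 0ℤ; 1ℤ; -1ℤ)
open import Data.List.Base using (List; []; _∷_; _++_; map; foldr; replicate)
open import Data.Nat.Base as ℕ using (ℕ; zero; suc; _∸_; _≤_; _≤ᵇ_; _!)
open import Data.Nat.Properties using (_!≢0)
open import Data.Rational.Base as ℚ using (ℚ)
open import Data.Vec.Base as Vec using ([])
open import Relation.Binary.PropositionalEquality using (_≡_)
open import Relation.Nullary using (¬_)

-- The ground list E is indexed by Fin m, so that |E| = m and the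
-- subsets A ⊆ E are the values of Subset m; E itself is ⊤.
record Matroid (m : ℕ) : Set where
  field
    rk            : Subset m → ℕ
    rk-bounded    : ∀ A → rk A ≤ ∣ A ∣
    rk-monotone   : ∀ {A B} → A ⊆ B → rk A ≤ rk B
    rk-submodular : ∀ A B → rk (A ∪ B) ℕ.+ rk (A ∩ B) ≤ rk A ℕ.+ rk B

  rank : ℕ
  rank = rk ⊤

  IsLoop : Fin m → Set
  IsLoop v = rk ⁅ v ⁆ ≡ 0

  Loopless : Set
  Loopless = ∀ v → ¬ IsLoop v

open Matroid public using (rank; Loopless)

-- Polynomials in t over ℤ, as lists of coefficients with the constant term
-- first. Trailing zeros are allowed; coeff does not see them.
Poly : Set
Poly = List ℤ

infixl 6 _+ₚ_
_+ₚ_ : Poly → Poly → Poly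
[]       +ₚ q        = q
(c ∷ p)  +ₚ []       = c ∷ p
(c ∷ p)  +ₚ (d ∷ q)  = (c ℤ.+ d) ∷ (p +ₚ q)

infix 7 _·t^_
_·t^_ : ℤ → ℕ → Poly
c ·t^ n = replicate n 0ℤ ++ (c ∷ [])

coeff : Poly → ℕ → ℤ
coeff []      _       = 0ℤ
coeff (c ∷ p) zero    = c
coeff (c ∷ p) (suc n) = coeff p n

subsets : ∀ m → List (Subset m)
subsets zero    = [] ∷ []
subsets (suc m) = map (outside Vec.∷_) (subsets m) ++ map (inside Vec.∷_) (subsets m)

-- The truncated subtraction is exact, since rk A ≤ rk ⊤ by monotonicity.
χ : ∀ {m} → Matroid m → Poly
χ {m} M = foldr _+ₚ_ [] (map term (subsets m))
  where
  open Matroid M using (rk)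
  term : Subset m → Poly
  term A = (-1ℤ ℤ.^ ∣ A ∣) ·t^ (rk ⊤ ∸ rk A)

-- a M i is the aᵢ of χ(M; t) = a₀tʳ − a₁tʳ⁻¹ + ⋯ + (−1)ʳaᵣ, where r = rank M,
-- with aᵢ = 0 for i > r: the coefficient of tʳ⁻ⁱ is (−1)ⁱaᵢ. No exponent
-- rk ⊤ ∸ rk A exceeds r, so these account for all of χ.
a : ∀ {m} → Matroid m → ℕ → ℤ
a M i = if i ≤ᵇ rank M
        then (-1ℤ ℤ.^ i) ℤ.* coeff (χ M) (rank M ∸ i)
        else 0ℤ

falling : ℤ → ℕ → ℤ
falling α zero    = 1ℤ
falling α (suc k) = falling α k ℤ.* (α ℤ.- + k)

-- The generalized binomial coefficient α(α−1)⋯(α−k+1) / k!, at integers α,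
-- possibly negative.
binom : ℤ → ℕ → ℚ
binom α k = (falling α k ℚ./ (k !)) {{k !≢0}}

fromℤ : ℤ → ℚ
fromℤ z = z ℚ./ 1

-- Σ₀ k f = f 0 + ⋯ + f k, with both endpoints included.
Σ₀ : ℕ → (ℕ → ℚ) → ℚ
Σ₀ zero    f = f 0
Σ₀ (suc k) f = Σ₀ k f ℚ.+ f (suc k)

{-# OPTIONS --safe #-}

-- Put A(x) = Σ aᵢxⁱ = Σ_A (−1)^|A| (−x)^(rk A), so that the middle sum is the
-- coefficient of xᵏ in (1 + x)^q A(x). Splitting the subsets by whether they
-- contain a non-loop e gives A_M = A_{M∖e} + x A_{M/e} with no case distinction,
-- and A = 0 as soon as there is a loop. Both bounds then follow by induction on
-- |E| from Pascal's rule. When e is a coloop, M∖e and M/e have the same rank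
-- function, A_M = (1 + x) A_{M∖e}, and q is replaced by q + 1. Otherwise
-- k ≤ q + r + 1 keeps the binomial coefficients that arise nonnegative, also
-- where M/e has loops. The last two claims are the cases q = −1 and q = k − r − 1.
module Submission where

open import Defs
open import Data.Nat.Base as ℕ using (ℕ; zero; suc; _∸_; _!; z≤n; s≤s)
open import Data.Nat.Properties as ℕ using (_!≢0)
open import Data.Integer.Base as ℤ using (ℤ; +_; 0ℤ; 1ℤ; -1ℤ; +≤+)
import Data.Integer.Properties as ℤ
open import Data.Integer.Tactic.RingSolver using (solve-∀)
open import Data.Rational.Base as ℚ using (ℚ; 0ℚ; 1ℚ)
import Data.Rational.Properties as ℚ
open import Data.Rational.Solver using (module +-*-Solver)
open import Data.Rational.Unnormalised.Base as ℚᵘ using (mkℚᵘ; *≡*)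
import Data.Rational.Unnormalised.Properties as ℚᵘ
open import Data.Bool.Base using (true; false; T)
open import Data.Fin.Base using (zero; suc)
open import Data.Fin.Properties using (any?)
open import Data.Fin.Subset using (Subset; inside; outside; ⊤; ⊥; ⁅_⁆; _∪_; _∩_; ∣_∣)
open import Data.Fin.Subset.Properties using (s⊆s; out⊆; ⊆-max; ⊆-refl; ⊆-min; ∪-identityˡ; ∩-zeroˡ; ∪-zeroʳ; ∩-identityʳ; ∣⁅x⁆∣≡1; ∣⊤∣≡n)
open import Data.List.Base using (List; []; _∷_; map; foldr; _++_)
open import Data.List.Properties using (map-++; map-∘)
open import Data.Product.Base using (_×_; _,_; proj₁; proj₂)
open import Data.Sum.Base using (_⊎_; inj₁; inj₂)
open import Data.Vec.Base using ([]; _∷_)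
open import Function.Base using (_∘_)
open import Relation.Binary.PropositionalEquality
open import Relation.Nullary using (¬_; yes; no; contradiction)

module ℚS = +-*-Solver

-- Falling factorials at integer arguments.

-- `falling` splits off the last factor; Pascal's rule and reflection need the first one split off
-- instead.
falling-shift : ∀ α k → falling (1ℤ ℤ.+ α) (suc k) ≡ (1ℤ ℤ.+ α) ℤ.* falling α k
falling-shift α zero = lem α
  where
  lem : ∀ α → 1ℤ ℤ.* ((1ℤ ℤ.+ α) ℤ.- 0ℤ) ≡ (1ℤ ℤ.+ α) ℤ.* 1ℤ
  lem = solve-∀
falling-shift α (suc k) = begin
  falling (1ℤ ℤ.+ α) (suc k) ℤ.* ((1ℤ ℤ.+ α) ℤ.- (1ℤ ℤ.+ + k))
    ≡⟨ cong (ℤ._* ((1ℤ ℤ.+ α) ℤ.- (1ℤ ℤ.+ + k))) (falling-shift α k) ⟩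
  (1ℤ ℤ.+ α) ℤ.* falling α k ℤ.* ((1ℤ ℤ.+ α) ℤ.- (1ℤ ℤ.+ + k))
    ≡⟨ lem α (+ k) (falling α k) ⟩
  (1ℤ ℤ.+ α) ℤ.* (falling α k ℤ.* (α ℤ.- + k)) ∎
  where
  open ≡-Reasoning
  lem : ∀ α κ f → (1ℤ ℤ.+ α) ℤ.* f ℤ.* ((1ℤ ℤ.+ α) ℤ.- (1ℤ ℤ.+ κ)) ≡ (1ℤ ℤ.+ α) ℤ.* (f ℤ.* (α ℤ.- κ))
  lem = solve-∀

falling-pascal : ∀ α k →
  falling (1ℤ ℤ.+ α) (suc k) ≡ falling α (suc k) ℤ.+ + suc k ℤ.* falling α k
falling-pascal α k = trans (falling-shift α k) (lem α (+ k) (falling α k))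
  where
  lem : ∀ α κ f → (1ℤ ℤ.+ α) ℤ.* f ≡ f ℤ.* (α ℤ.- κ) ℤ.+ (1ℤ ℤ.+ κ) ℤ.* f
  lem = solve-∀

+-cancelˡ-≤ : ∀ k {i j} → k ℤ.+ i ℤ.≤ k ℤ.+ j → i ℤ.≤ j
+-cancelˡ-≤ k {i} {j} h = subst₂ ℤ._≤_ (lem k i) (lem k j) (ℤ.+-monoʳ-≤ (ℤ.- k) h)
  where
  lem : ∀ k i → ℤ.- k ℤ.+ (k ℤ.+ i) ≡ i
  lem = solve-∀

-- The hypothesis says that the smallest factor, α - k + 1, is nonnegative. In the extreme case k =
-- α + 1 that factor is 0.
falling-nonneg : ∀ α k → + k ℤ.≤ α ℤ.+ 1ℤ → 0ℤ ℤ.≤ falling α k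
falling-nonneg α zero    _ = +≤+ z≤n
falling-nonneg α (suc k) h = subst (ℤ._≤ falling α (suc k)) (ℤ.*-zeroʳ (falling α k))
  (ℤ.*-monoˡ-≤-nonNeg (falling α k) {{ℤ.nonNegative (falling-nonneg α k k≤)}} (ℤ.i≤j⇒0≤j-i k≤α))
  where
  k≤α : + k ℤ.≤ α
  k≤α = +-cancelˡ-≤ 1ℤ (subst (+ suc k ℤ.≤_) (ℤ.+-comm α 1ℤ) h)
  k≤ : + k ℤ.≤ α ℤ.+ 1ℤ
  k≤ = ℤ.≤-trans k≤α (ℤ.i≤i+j α 1ℤ)

-- The factors on the left are the negatives of those of `falling β j` in reverse order, so the
-- induction peels the first factor on the left and the last one on the right.
falling-reflect : ∀ β j → falling (+ j ℤ.- β ℤ.- 1ℤ) j ≡ (-1ℤ ℤ.^ j) ℤ.* falling β j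
falling-reflect β zero    = refl
falling-reflect β (suc j) = begin
  falling (+ suc j ℤ.- β ℤ.- 1ℤ) (suc j)            ≡⟨ cong (λ α → falling α (suc j)) (lem₁ (+ j) β) ⟩
  falling (1ℤ ℤ.+ (+ j ℤ.- β ℤ.- 1ℤ)) (suc j)       ≡⟨ falling-shift (+ j ℤ.- β ℤ.- 1ℤ) j ⟩
  (1ℤ ℤ.+ (+ j ℤ.- β ℤ.- 1ℤ)) ℤ.* falling (+ j ℤ.- β ℤ.- 1ℤ) j
    ≡⟨ cong ((1ℤ ℤ.+ (+ j ℤ.- β ℤ.- 1ℤ)) ℤ.*_) (falling-reflect β j) ⟩
  (1ℤ ℤ.+ (+ j ℤ.- β ℤ.- 1ℤ)) ℤ.* ((-1ℤ ℤ.^ j) ℤ.* falling β j)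
    ≡⟨ lem₂ (+ j) β (-1ℤ ℤ.^ j) (falling β j) ⟩
  (-1ℤ ℤ.^ suc j) ℤ.* falling β (suc j) ∎
  where
  open ≡-Reasoning
  lem₁ : ∀ κ β → (1ℤ ℤ.+ κ) ℤ.- β ℤ.- 1ℤ ≡ 1ℤ ℤ.+ (κ ℤ.- β ℤ.- 1ℤ)
  lem₁ = solve-∀
  lem₂ : ∀ κ β s f → (1ℤ ℤ.+ (κ ℤ.- β ℤ.- 1ℤ)) ℤ.* (s ℤ.* f) ≡ (ℤ.- 1ℤ ℤ.* s) ℤ.* (f ℤ.* (β ℤ.- κ))
  lem₂ = solve-∀

-- Fractions with integer numerators.

fromℚᵘ-homo-+ : ∀ p q → ℚ.fromℚᵘ (p ℚᵘ.+ q) ≡ ℚ.fromℚᵘ p ℚ.+ ℚ.fromℚᵘ q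
fromℚᵘ-homo-+ p q = ℚ.toℚᵘ-injective (begin
  ℚ.toℚᵘ (ℚ.fromℚᵘ (p ℚᵘ.+ q))                      ≈⟨ ℚ.toℚᵘ-fromℚᵘ (p ℚᵘ.+ q) ⟩
  p ℚᵘ.+ q                                          ≈⟨ ℚᵘ.+-cong (ℚ.toℚᵘ-fromℚᵘ p) (ℚ.toℚᵘ-fromℚᵘ q) ⟨
  ℚ.toℚᵘ (ℚ.fromℚᵘ p) ℚᵘ.+ ℚ.toℚᵘ (ℚ.fromℚᵘ q)      ≈⟨ ℚ.toℚᵘ-homo-+ (ℚ.fromℚᵘ p) (ℚ.fromℚᵘ q) ⟨
  ℚ.toℚᵘ (ℚ.fromℚᵘ p ℚ.+ ℚ.fromℚᵘ q)                ∎)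
  where open import Relation.Binary.Reasoning.Setoid ℚᵘ.≃-setoid

fromℚᵘ-homo-* : ∀ p q → ℚ.fromℚᵘ (p ℚᵘ.* q) ≡ ℚ.fromℚᵘ p ℚ.* ℚ.fromℚᵘ q
fromℚᵘ-homo-* p q = ℚ.toℚᵘ-injective (begin
  ℚ.toℚᵘ (ℚ.fromℚᵘ (p ℚᵘ.* q))                      ≈⟨ ℚ.toℚᵘ-fromℚᵘ (p ℚᵘ.* q) ⟩
  p ℚᵘ.* q                                          ≈⟨ ℚᵘ.*-cong (ℚ.toℚᵘ-fromℚᵘ p) (ℚ.toℚᵘ-fromℚᵘ q) ⟨
  ℚ.toℚᵘ (ℚ.fromℚᵘ p) ℚᵘ.* ℚ.toℚᵘ (ℚ.fromℚᵘ q)      ≈⟨ ℚ.toℚᵘ-homo-* (ℚ.fromℚᵘ p) (ℚ.fromℚᵘ q) ⟨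
  ℚ.toℚᵘ (ℚ.fromℚᵘ p ℚ.* ℚ.fromℚᵘ q)                ∎)
  where open import Relation.Binary.Reasoning.Setoid ℚᵘ.≃-setoid

-- Checked on unnormalised fractions, where it becomes a cross-multiplied identity in ℤ.
/-distribʳ-+ : ∀ i j n .{{_ : ℕ.NonZero n}} → (i ℤ.+ j) ℚ./ n ≡ i ℚ./ n ℚ.+ j ℚ./ n
/-distribʳ-+ i j n@(suc d) = trans
  (ℚ.fromℚᵘ-cong {mkℚᵘ (i ℤ.+ j) d} {mkℚᵘ i d ℚᵘ.+ mkℚᵘ j d} (*≡* (lem i j (+ n))))
  (fromℚᵘ-homo-+ (mkℚᵘ i d) (mkℚᵘ j d))
  where
  lem : ∀ i j ν → (i ℤ.+ j) ℤ.* (ν ℤ.* ν) ≡ (i ℤ.* ν ℤ.+ j ℤ.* ν) ℤ.* ν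
  lem = solve-∀

/-cancelˡ-* : ∀ c i n .{{_ : ℕ.NonZero n}} .{{_ : ℕ.NonZero (suc c ℕ.* n)}} →
              (+ suc c ℤ.* i) ℚ./ (suc c ℕ.* n) ≡ i ℚ./ n
/-cancelˡ-* c i n@(suc d) = ℚ.fromℚᵘ-cong {mkℚᵘ (+ suc c ℤ.* i) (d ℕ.+ c ℕ.* n)} {mkℚᵘ i d}
  (*≡* (trans (lem (+ suc c) i (+ n)) (cong (i ℤ.*_) (sym (ℤ.pos-* (suc c) n)))))
  where
  lem : ∀ γ i ν → γ ℤ.* i ℤ.* ν ≡ i ℤ.* (γ ℤ.* ν)
  lem = solve-∀

fromℤ-* : ∀ i j → fromℤ (i ℤ.* j) ≡ fromℤ i ℚ.* fromℤ j
fromℤ-* i j = fromℚᵘ-homo-* (mkℚᵘ i 0) (mkℚᵘ j 0)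

fromℤ-+ : ∀ i j → fromℤ (i ℤ.+ j) ≡ fromℤ i ℚ.+ fromℤ j
fromℤ-+ i j = /-distribʳ-+ i j 1

*-/-assoc : ∀ i j n .{{_ : ℕ.NonZero n}} → (i ℤ.* j) ℚ./ n ≡ fromℤ i ℚ.* (j ℚ./ n)
*-/-assoc i j n@(suc d) = trans
  (ℚ.fromℚᵘ-cong {mkℚᵘ (i ℤ.* j) d} {mkℚᵘ i 0 ℚᵘ.* mkℚᵘ j d}
    (*≡* (cong (λ ν → i ℤ.* j ℤ.* + ν) (ℕ.*-identityˡ n))))
  (fromℚᵘ-homo-* (mkℚᵘ i 0) (mkℚᵘ j d))

-- Generalized binomial coefficients.

binom-pascal : ∀ α k → binom (1ℤ ℤ.+ α) (suc k) ≡ binom α (suc k) ℚ.+ binom α k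
binom-pascal α k = begin
  falling (1ℤ ℤ.+ α) (suc k) ℚ./ suc k !
    ≡⟨ cong (ℚ._/ (suc k !)) (falling-pascal α k) ⟩
  (falling α (suc k) ℤ.+ + suc k ℤ.* falling α k) ℚ./ suc k !
    ≡⟨ /-distribʳ-+ (falling α (suc k)) (+ suc k ℤ.* falling α k) (suc k !) ⟩
  binom α (suc k) ℚ.+ (+ suc k ℤ.* falling α k) ℚ./ suc k !
    -- `suc k !` unfolds to `suc k * k !`, so the factor `suc k` from `falling-pascal` cancels.
    ≡⟨ cong (binom α (suc k) ℚ.+_) (/-cancelˡ-* k (falling α k) (k !)) ⟩
  binom α (suc k) ℚ.+ binom α k ∎
  where
  open ≡-Reasoning
  instance
    _ = k !≢0
    _ = suc k !≢0

binom-nonneg : ∀ α k → + k ℤ.≤ α ℤ.+ 1ℤ → 0ℚ ℚ.≤ binom α k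
binom-nonneg α k h with falling α k | falling-nonneg α k h
... | + n | _ = ℚ.nonNegative⁻¹ _ {{ℚ.normalize-nonNeg n (k !) {{k !≢0}}}}

binom-reflect : ∀ β j → binom (+ j ℤ.- β ℤ.- 1ℤ) j ≡ fromℤ (-1ℤ ℤ.^ j) ℚ.* binom β j
binom-reflect β j = trans (cong (λ i → (i ℚ./ (j !)) {{j !≢0}}) (falling-reflect β j))
  (*-/-assoc (-1ℤ ℤ.^ j) (falling β j) (j !) {{j !≢0}})

falling-0-suc : ∀ k → falling 0ℤ (suc k) ≡ 0ℤ
falling-0-suc k = trans (falling-shift -1ℤ k) (ℤ.*-zeroˡ (falling -1ℤ k))

-- Pascal's rule at α = -1 has `binom 0ℤ (suc k)`, which is 0, on its left, so consecutive values
-- differ by a sign.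
binom--1 : ∀ k → binom -1ℤ k ≡ fromℤ (-1ℤ ℤ.^ k)
binom--1 zero    = refl
binom--1 (suc k) = begin
  binom -1ℤ (suc k)                                  ≡⟨ lem (binom -1ℤ (suc k)) (binom -1ℤ k) ⟩
  (binom -1ℤ (suc k) ℚ.+ binom -1ℤ k) ℚ.- binom -1ℤ k  ≡⟨ cong (ℚ._- binom -1ℤ k) (binom-pascal -1ℤ k) ⟨
  binom 0ℤ (suc k) ℚ.- binom -1ℤ k                   ≡⟨ cong₂ ℚ._-_ binom-0-suc (binom--1 k) ⟩
  0ℚ ℚ.- fromℤ (-1ℤ ℤ.^ k)                           ≡⟨ lem₂ (fromℤ (-1ℤ ℤ.^ k)) ⟩
  fromℤ -1ℤ ℚ.* fromℤ (-1ℤ ℤ.^ k)                    ≡⟨ fromℤ-* -1ℤ (-1ℤ ℤ.^ k) ⟨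
  fromℤ (-1ℤ ℤ.^ suc k) ∎
  where
  open ≡-Reasoning
  open ℚS using (_:=_; _:+_; _:*_; :-_; _:-_; con)
  lem : ∀ x y → x ≡ (x ℚ.+ y) ℚ.- y
  lem = ℚS.solve 2 (λ x y → x := (x :+ y) :- y) refl
  lem₂ : ∀ y → 0ℚ ℚ.- y ≡ fromℤ -1ℤ ℚ.* y
  lem₂ = ℚS.solve 1 (λ y → con 0ℚ :- y := con (fromℤ -1ℤ) :* y) refl
  binom-0-suc : binom 0ℤ (suc k) ≡ 0ℚ
  binom-0-suc = trans (cong (λ i → (i ℚ./ (suc k !)) {{suc k !≢0}}) (falling-0-suc k))
    (ℚ.0/n≡0 (suc k !) {{suc k !≢0}})

-- Finite sums and convolution.

Σ₀-cong : ∀ k {f g : ℕ → ℚ} → (∀ i → i ℕ.≤ k → f i ≡ g i) → Σ₀ k f ≡ Σ₀ k g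
Σ₀-cong zero    h = h 0 z≤n
Σ₀-cong (suc k) h = cong₂ ℚ._+_ (Σ₀-cong k (λ i i≤k → h i (ℕ.m≤n⇒m≤1+n i≤k))) (h (suc k) ℕ.≤-refl)

Σ₀-suc : ∀ k (f : ℕ → ℚ) → Σ₀ (suc k) f ≡ f 0 ℚ.+ Σ₀ k (f ∘ suc)
Σ₀-suc zero    f = refl
Σ₀-suc (suc k) f = trans (cong (ℚ._+ f (suc (suc k))) (Σ₀-suc k f))
  (ℚ.+-assoc (f 0) (Σ₀ k (f ∘ suc)) (f (suc (suc k))))

Σ₀-*ˡ : ∀ k x (f : ℕ → ℚ) → x ℚ.* Σ₀ k f ≡ Σ₀ k (λ i → x ℚ.* f i)
Σ₀-*ˡ zero    x f = refl
Σ₀-*ˡ (suc k) x f = trans (ℚ.*-distribˡ-+ x (Σ₀ k f) (f (suc k)))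
  (cong (ℚ._+ x ℚ.* f (suc k)) (Σ₀-*ˡ k x f))

Σ₀-0 : ∀ k → Σ₀ k (λ _ → 0ℚ) ≡ 0ℚ
Σ₀-0 zero    = refl
Σ₀-0 (suc k) = cong (ℚ._+ 0ℚ) (Σ₀-0 k)

-- The Cauchy product: the coefficient of tᵏ in the product of the generating functions of `b` and
-- `x`.
conv : (ℕ → ℚ) → (ℕ → ℚ) → ℕ → ℚ
conv b x k = Σ₀ k (λ i → b (k ∸ i) ℚ.* x i)

conv-suc : ∀ b x k → conv b x (suc k) ≡ b (suc k) ℚ.* x 0 ℚ.+ conv b (x ∘ suc) k
conv-suc b x k = Σ₀-suc k (λ i → b (suc k ∸ i) ℚ.* x i)

conv-congʳ : ∀ b {x y} k → (∀ i → x i ≡ y i) → conv b x k ≡ conv b y k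
conv-congʳ b k h = Σ₀-cong k (λ i _ → cong (b (k ∸ i) ℚ.*_) (h i))

conv-zeroʳ : ∀ b {x} k → (∀ i → x i ≡ 0ℚ) → conv b x k ≡ 0ℚ
conv-zeroʳ b k h = trans
  (Σ₀-cong k (λ i _ → trans (cong (b (k ∸ i) ℚ.*_) (h i)) (ℚ.*-zeroʳ (b (k ∸ i)))))
  (Σ₀-0 k)

conv-distribˡ-+ : ∀ b x y k → conv b (λ i → x i ℚ.+ y i) k ≡ conv b x k ℚ.+ conv b y k
-- The weights `b (k ∸ i)` change with the upper limit, so the induction is on sums with weights `β`
-- independent of it.
conv-distribˡ-+ b x y k = go k (b ∘ (k ∸_))
  where
  open ℚS using (_:=_; _:+_; _:*_)
  lem : ∀ p q β u v → (p ℚ.+ q) ℚ.+ β ℚ.* (u ℚ.+ v) ≡ (p ℚ.+ β ℚ.* u) ℚ.+ (q ℚ.+ β ℚ.* v)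
  lem = ℚS.solve 5 (λ p q β u v → (p :+ q) :+ β :* (u :+ v) := (p :+ β :* u) :+ (q :+ β :* v)) refl
  go : ∀ n (β : ℕ → ℚ) → Σ₀ n (λ i → β i ℚ.* (x i ℚ.+ y i))
                       ≡ Σ₀ n (λ i → β i ℚ.* x i) ℚ.+ Σ₀ n (λ i → β i ℚ.* y i)
  go zero    β = ℚ.*-distribˡ-+ (β 0) (x 0) (y 0)
  go (suc n) β = trans (cong (ℚ._+ β (suc n) ℚ.* (x (suc n) ℚ.+ y (suc n))) (go n β))
    (lem (Σ₀ n (λ i → β i ℚ.* x i)) (Σ₀ n (λ i → β i ℚ.* y i)) (β (suc n)) (x (suc n)) (y (suc n)))

-- In terms of generating functions: z = x + t y implies b z = b x + t (b y).
conv-step : ∀ b {x y z} → z 0 ≡ x 0 → (∀ i → z (suc i) ≡ x (suc i) ℚ.+ y i) →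
            ∀ k → conv b z (suc k) ≡ conv b x (suc k) ℚ.+ conv b y k
conv-step b {x} {y} {z} z₀ z₊ k = begin
  conv b z (suc k)                                                     ≡⟨ conv-suc b z k ⟩
  b (suc k) ℚ.* z 0 ℚ.+ conv b (z ∘ suc) k
    ≡⟨ cong₂ (λ u v → b (suc k) ℚ.* u ℚ.+ v) z₀ (conv-congʳ b k z₊) ⟩
  b (suc k) ℚ.* x 0 ℚ.+ conv b (λ i → x (suc i) ℚ.+ y i) k
    ≡⟨ cong (b (suc k) ℚ.* x 0 ℚ.+_) (conv-distribˡ-+ b (x ∘ suc) y k) ⟩
  b (suc k) ℚ.* x 0 ℚ.+ (conv b (x ∘ suc) k ℚ.+ conv b y k)
    ≡⟨ ℚ.+-assoc (b (suc k) ℚ.* x 0) (conv b (x ∘ suc) k) (conv b y k) ⟨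
  b (suc k) ℚ.* x 0 ℚ.+ conv b (x ∘ suc) k ℚ.+ conv b y k
    ≡⟨ cong (ℚ._+ conv b y k) (conv-suc b x k) ⟨
  conv b x (suc k) ℚ.+ conv b y k ∎
  where open ≡-Reasoning

-- By Pascal's rule, passing from q to 1 + q multiplies the generating function of `binom q` by 1 +
-- t. The induction peels off `x 0`.
conv-pascal : ∀ q x k → conv (binom (1ℤ ℤ.+ q)) x (suc k)
                      ≡ conv (binom q) x (suc k) ℚ.+ conv (binom q) x k
-- Pascal's rule does not reach lower index 0: the term with `x 1` has coefficient 1 on both sides.
conv-pascal q x zero = trans
  (cong (λ u → u ℚ.* x 0 ℚ.+ 1ℚ ℚ.* x 1) (binom-pascal q 0))
  (lem (binom q 1) (x 0) (1ℚ ℚ.* x 1))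
  where
  open ℚS using (_:=_; _:+_; _:*_; con)
  lem : ∀ b u v → (b ℚ.+ 1ℚ) ℚ.* u ℚ.+ v ≡ (b ℚ.* u ℚ.+ v) ℚ.+ 1ℚ ℚ.* u
  lem = ℚS.solve 3 (λ b u v → (b :+ con 1ℚ) :* u :+ v := (b :* u :+ v) :+ con 1ℚ :* u) refl
conv-pascal q x (suc k) = begin
  conv (binom (1ℤ ℤ.+ q)) x (suc (suc k))
    ≡⟨ conv-suc (binom (1ℤ ℤ.+ q)) x (suc k) ⟩
  binom (1ℤ ℤ.+ q) (suc (suc k)) ℚ.* x 0 ℚ.+ conv (binom (1ℤ ℤ.+ q)) (x ∘ suc) (suc k)
    ≡⟨ cong₂ (λ u v → u ℚ.* x 0 ℚ.+ v) (binom-pascal q (suc k)) (conv-pascal q (x ∘ suc) k) ⟩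
  (binom q (suc (suc k)) ℚ.+ binom q (suc k)) ℚ.* x 0
    ℚ.+ (conv (binom q) (x ∘ suc) (suc k) ℚ.+ conv (binom q) (x ∘ suc) k)
    ≡⟨ lem (binom q (suc (suc k))) (binom q (suc k)) (x 0) _ _ ⟩
  (binom q (suc (suc k)) ℚ.* x 0 ℚ.+ conv (binom q) (x ∘ suc) (suc k))
    ℚ.+ (binom q (suc k) ℚ.* x 0 ℚ.+ conv (binom q) (x ∘ suc) k)
    ≡⟨ cong₂ ℚ._+_ (conv-suc (binom q) x (suc k)) (conv-suc (binom q) x k) ⟨
  conv (binom q) x (suc (suc k)) ℚ.+ conv (binom q) x (suc k) ∎
  where
  open ≡-Reasoning
  open ℚS using (_:=_; _:+_; _:*_)
  lem : ∀ b c u v w → (b ℚ.+ c) ℚ.* u ℚ.+ (v ℚ.+ w) ≡ (b ℚ.* u ℚ.+ v) ℚ.+ (c ℚ.* u ℚ.+ w)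
  lem = ℚS.solve 5 (λ b c u v w → (b :+ c) :* u :+ (v :+ w) := (b :* u :+ v) :+ (c :* u :+ w)) refl

-- Signed sums over subsets, graded by rank.

-- The coefficient of xⁱ in (-x)ⁿ.
δ : ℕ → ℕ → ℤ
δ zero    zero    = 1ℤ
δ (suc n) (suc i) = ℤ.- δ n i
δ _       _       = 0ℤ

-- The coefficient of xⁱ in Σ_A (−1)^|A| (−x)^(ρ A).
whitney : ∀ m → (Subset m → ℕ) → ℕ → ℤ
whitney zero    ρ i = δ (ρ []) i
whitney (suc m) ρ i = whitney m (ρ ∘ (outside ∷_)) i ℤ.- whitney m (ρ ∘ (inside ∷_)) i

whitney-cong : ∀ m {ρ σ} → (∀ A → ρ A ≡ σ A) → ∀ i → whitney m ρ i ≡ whitney m σ i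
whitney-cong zero    h i = cong (λ n → δ n i) (h [])
whitney-cong (suc m) h i = cong₂ ℤ._-_ (whitney-cong m (h ∘ (outside ∷_)) i) (whitney-cong m (h ∘ (inside ∷_)) i)

-- Raising every rank by 1 multiplies the polynomial by -x; this lemma and the next read that off
-- coefficientwise.
whitney-shift-zero : ∀ m ρ → whitney m (suc ∘ ρ) 0 ≡ 0ℤ
whitney-shift-zero zero    ρ = refl
whitney-shift-zero (suc m) ρ = cong₂ ℤ._-_ (whitney-shift-zero m (ρ ∘ (outside ∷_))) (whitney-shift-zero m (ρ ∘ (inside ∷_)))

whitney-shift-suc : ∀ m ρ i → whitney m (suc ∘ ρ) (suc i) ≡ ℤ.- whitney m ρ i
whitney-shift-suc zero    ρ i = refl
whitney-shift-suc (suc m) ρ i = trans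
  (cong₂ ℤ._-_ (whitney-shift-suc m (ρ ∘ (outside ∷_)) i) (whitney-shift-suc m (ρ ∘ (inside ∷_)) i))
  (lem (whitney m (ρ ∘ (outside ∷_)) i) (whitney m (ρ ∘ (inside ∷_)) i))
  where
  lem : ∀ x y → ℤ.- x ℤ.- ℤ.- y ≡ ℤ.- (x ℤ.- y)
  lem = solve-∀

-- Deletion and contraction of the first element e.

module _ {m} (M : Matroid (suc m)) where
  open Matroid M using (rk; rk-bounded; rk-monotone; rk-submodular)

  private
    e : ℕ
    e = rk (inside ∷ ⊥)

  -- Submodularity for {e} and A, which meet in the empty set.
  add-≤ : ∀ A → rk (inside ∷ A) ℕ.+ rk (outside ∷ ⊥) ℕ.≤ e ℕ.+ rk (outside ∷ A)
  add-≤ A = subst₂ (λ P Q → rk (inside ∷ P) ℕ.+ rk (outside ∷ Q) ℕ.≤ e ℕ.+ rk (outside ∷ A))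
    (∪-identityˡ A) (∩-zeroˡ A) (rk-submodular (inside ∷ ⊥) (outside ∷ A))

  rk-add-≤ : ∀ A → rk (inside ∷ A) ℕ.≤ e ℕ.+ rk (outside ∷ A)
  rk-add-≤ A = ℕ.≤-trans (ℕ.m≤m+n _ _) (add-≤ A)

  out≤in : ∀ A → rk (outside ∷ A) ℕ.≤ rk (inside ∷ A)
  out≤in A = rk-monotone (out⊆ ⊆-refl)

  loop-in≡out : e ≡ 0 → ∀ A → rk (inside ∷ A) ≡ rk (outside ∷ A)
  loop-in≡out e≡0 A = ℕ.≤-antisym
    (subst (λ n → rk (inside ∷ A) ℕ.≤ n ℕ.+ rk (outside ∷ A)) e≡0 (rk-add-≤ A)) (out≤in A)

  singleton≤1 : e ℕ.≤ 1
  singleton≤1 = subst (e ℕ.≤_) (∣⁅x⁆∣≡1 (zero {m})) (rk-bounded (inside ∷ ⊥))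

  nonloop-rk≡1 : ¬ e ≡ 0 → e ≡ 1
  nonloop-rk≡1 e≢0 = ℕ.≤-antisym singleton≤1 (ℕ.n≢0⇒n>0 e≢0)

  delete : Matroid m
  delete = record
    { rk            = rk ∘ (outside ∷_)
    ; rk-bounded    = λ A → rk-bounded (outside ∷ A)
    ; rk-monotone   = λ A⊆B → rk-monotone (s⊆s A⊆B)
    ; rk-submodular = λ A B → rk-submodular (outside ∷ A) (outside ∷ B)
    }

  module _ (e≡1 : e ≡ 1) where

    -- A set containing the non-loop e has rank at least 1, so the predecessor is exact.
    suc-pred-rk : ∀ A → suc (ℕ.pred (rk (inside ∷ A))) ≡ rk (inside ∷ A)
    suc-pred-rk A = ℕ.suc-pred _ {{ℕ.>-nonZero (ℕ.≤-trans (ℕ.≤-reflexive (sym e≡1)) (rk-monotone (s⊆s (⊆-min A))))}}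

    private
      pred-rk≤ : ∀ A → ℕ.pred (rk (inside ∷ A)) ℕ.≤ rk (outside ∷ A)
      pred-rk≤ A = ℕ.pred-mono-≤ (subst (λ n → rk (inside ∷ A) ℕ.≤ n ℕ.+ rk (outside ∷ A)) e≡1 (rk-add-≤ A))

    -- The rank in M/e is rk(A ∪ {e}) - rk({e}), and rk({e}) = 1 here.
    contract : Matroid m
    contract = record
      { rk            = ℕ.pred ∘ rk ∘ (inside ∷_)
      ; rk-bounded    = λ A → ℕ.≤-trans (pred-rk≤ A) (rk-bounded (outside ∷ A))
      ; rk-monotone   = λ A⊆B → ℕ.pred-mono-≤ (rk-monotone (s⊆s A⊆B))
      -- Each side has two predecessors; adding 2 to both gives submodularity in M for A ∪ {e} and B
      -- ∪ {e}.
      ; rk-submodular = λ A B → ℕ.s≤s⁻¹ (ℕ.s≤s⁻¹ (subst₂ ℕ._≤_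
          (sym (split (A ∪ B) (A ∩ B))) (sym (split A B)) (rk-submodular (inside ∷ A) (inside ∷ B))))
      }
      where
      split : ∀ A B → 2 ℕ.+ (ℕ.pred (rk (inside ∷ A)) ℕ.+ ℕ.pred (rk (inside ∷ B)))
                    ≡ rk (inside ∷ A) ℕ.+ rk (inside ∷ B)
      split A B = trans (cong suc (sym (ℕ.+-suc _ _))) (cong₂ ℕ._+_ (suc-pred-rk A) (suc-pred-rk B))

    rank-contract : suc (rank contract) ≡ rank M
    rank-contract = suc-pred-rk ⊤

    -- Submodularity for A ∪ {e} and E without e, whose union is E and whose intersection is A,
    -- gives rk(A) + 1 ≤ rk(A ∪ {e}).
    coloop-in≡suc-out : rank M ≡ suc (rank delete) → ∀ A → ℕ.pred (rk (inside ∷ A)) ≡ rk (outside ∷ A)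
    coloop-in≡suc-out coloop A = ℕ.≤-antisym (pred-rk≤ A) (ℕ.pred-mono-≤ (ℕ.+-cancelˡ-≤ (rank delete) _ _ (begin
      rank delete ℕ.+ suc (rk (outside ∷ A))  ≡⟨ ℕ.+-suc (rank delete) _ ⟩
      suc (rank delete) ℕ.+ rk (outside ∷ A)  ≡⟨ cong (ℕ._+ rk (outside ∷ A)) coloop ⟨
      rank M ℕ.+ rk (outside ∷ A)
        ≡⟨ cong₂ (λ P Q → rk (inside ∷ P) ℕ.+ rk (outside ∷ Q)) (∪-zeroʳ A) (∩-identityʳ A) ⟨
      rk (inside ∷ (A ∪ ⊤)) ℕ.+ rk (outside ∷ (A ∩ ⊤)) ≤⟨ rk-submodular (inside ∷ A) (outside ∷ ⊤) ⟩
      rk (inside ∷ A) ℕ.+ rank delete         ≡⟨ ℕ.+-comm _ (rank delete) ⟩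
      rank delete ℕ.+ rk (inside ∷ A)         ∎)))
      where open ℕ.≤-Reasoning

    rank-cases : rank M ≡ rank delete ⊎ rank M ≡ suc (rank delete)
    rank-cases with ℕ.m≤n⇒m<n∨m≡n (out≤in ⊤)
    ... | inj₂ eq = inj₁ (sym eq)
    ... | inj₁ lt = inj₂ (ℕ.≤-antisym (subst (λ n → rank M ℕ.≤ n ℕ.+ rank delete) e≡1 (rk-add-≤ ⊤)) lt)

-- Deletion-contraction for the coefficients, and the effect of loops.

coefs : ∀ {m} → Matroid m → ℕ → ℤ
coefs {m} M = whitney m (Matroid.rk M)

module _ {m} (M : Matroid (suc m)) (e≡1 : Matroid.rk M ⁅ zero ⁆ ≡ 1) where
  private
    pulled : ∀ i → whitney m (Matroid.rk M ∘ (inside ∷_)) i ≡ whitney m (ℕ.suc ∘ Matroid.rk (contract M e≡1)) i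
    pulled = whitney-cong m (sym ∘ suc-pred-rk M e≡1)

  coefs-zero : coefs M 0 ≡ coefs (delete M) 0
  coefs-zero = trans (cong (ℤ._-_ (coefs (delete M) 0)) (trans (pulled 0) (whitney-shift-zero m _)))
    (ℤ.+-identityʳ _)

  -- Two signs cancel: one for e joining the subset, one for its rank exceeding the rank in M/e by
  -- 1.
  coefs-suc : ∀ i → coefs M (suc i) ≡ coefs (delete M) (suc i) ℤ.+ coefs (contract M e≡1) i
  coefs-suc i = cong (ℤ._+_ (coefs (delete M) (suc i)))
    (trans (cong ℤ.-_ (trans (pulled (suc i)) (whitney-shift-suc m _ i))) (ℤ.neg-involutive _))

-- If e is a loop, the terms of A and A ∪ {e} cancel. Otherwise e can be contracted, and `v` remains
-- a loop in both minors.
loop⇒coefs≡0 : ∀ {m} (M : Matroid m) v → Matroid.IsLoop M v → ∀ i → coefs M i ≡ 0ℤ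
loop⇒coefs≡0 {suc m} M zero loop i = trans
  (cong (ℤ._-_ (coefs (delete M) i)) (whitney-cong m (loop-in≡out M loop) i))
  (ℤ.+-inverseʳ (coefs (delete M) i))
loop⇒coefs≡0 {suc m} M (suc v) loop i with Matroid.rk M ⁅ zero ⁆ ℕ.≟ 0
... | yes e≡0 = loop⇒coefs≡0 M zero e≡0 i
... | no  e≢0 = go i
  where
  e≡1 = nonloop-rk≡1 M e≢0
  contract-loop : Matroid.IsLoop (contract M e≡1) v
  -- The rank of {e, v} is at most 1 + 0, hence 0 after contracting e.
  contract-loop = ℕ.n≤0⇒n≡0 (ℕ.pred-mono-≤ (subst₂ (λ x y → Matroid.rk M (inside ∷ ⁅ v ⁆) ℕ.≤ x ℕ.+ y) e≡1 loop (rk-add-≤ M ⁅ v ⁆)))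
  go : ∀ i → coefs M i ≡ 0ℤ
  go zero    = trans (coefs-zero M e≡1) (loop⇒coefs≡0 (delete M) v loop 0)
  go (suc i) = trans (coefs-suc M e≡1 i)
    (cong₂ ℤ._+_ (loop⇒coefs≡0 (delete M) v loop (suc i)) (loop⇒coefs≡0 (contract M e≡1) v contract-loop i))

-- The two bounds by induction on the ground set.

-- The middle sum of the theorem with `coefs` in place of `a`; the two agree by `a≡coefs`.
W : ∀ {m} → Matroid m → ℤ → ℕ → ℚ
W M q = conv (binom q) (fromℤ ∘ coefs M)

-- Contraction can create loops, and then the induction hypothesis does not apply to M/e; its
-- contribution is 0 in that case.
loop-dichotomy : ∀ {m} (M : Matroid m) → Loopless M ⊎ (∀ q k → W M q k ≡ 0ℚ)
loop-dichotomy M with any? (λ v → Matroid.rk M ⁅ v ⁆ ℕ.≟ 0)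
... | yes (v , loop) = inj₂ (λ q k → conv-zeroʳ (binom q) k (cong fromℤ ∘ loop⇒coefs≡0 M v loop))
... | no  ¬loop      = inj₁ (λ v loop → ¬loop (v , loop))

-- Deletion alone suffices: it preserves looplessness, and M/e enters only from degree 1 on.
coefs-0≡1 : ∀ {m} (M : Matroid m) → Loopless M → coefs M 0 ≡ 1ℤ
coefs-0≡1 {zero}  M _  = cong (λ n → δ n 0) (ℕ.n≤0⇒n≡0 (Matroid.rk-bounded M []))
coefs-0≡1 {suc m} M ll = trans (coefs-zero M (nonloop-rk≡1 M (ll zero))) (coefs-0≡1 (delete M) (ll ∘ suc))

W-0≡1 : ∀ {m} (M : Matroid m) → Loopless M → ∀ q → W M q 0 ≡ 1ℚ
W-0≡1 M ll q = cong (λ z → 1ℚ ℚ.* fromℤ z) (coefs-0≡1 M ll)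

W-empty : ∀ (M : Matroid 0) q k → W M q k ≡ binom q k
W-empty M q zero    = W-0≡1 M (λ ()) q
W-empty M q (suc k) = begin
  W M q (suc k)  ≡⟨ conv-suc (binom q) (fromℤ ∘ coefs M) k ⟩
  binom q (suc k) ℚ.* fromℤ (coefs M 0) ℚ.+ conv (binom q) (λ i → fromℤ (coefs M (suc i))) k
    ≡⟨ cong₂ (λ x y → binom q (suc k) ℚ.* fromℤ x ℚ.+ y) (coefs-0≡1 M (λ ()))
         (conv-zeroʳ (binom q) k (λ i → cong (λ n → fromℤ (δ n (suc i))) (ℕ.n≤0⇒n≡0 (Matroid.rk-bounded M [])))) ⟩
  binom q (suc k) ℚ.* 1ℚ ℚ.+ 0ℚ  ≡⟨ ℚ.+-identityʳ _ ⟩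
  binom q (suc k) ℚ.* 1ℚ         ≡⟨ ℚ.*-identityʳ _ ⟩
  binom q (suc k) ∎
  where open ≡-Reasoning

module _ {m} (M : Matroid (suc m)) (e≡1 : Matroid.rk M ⁅ zero ⁆ ≡ 1) where

  W-step : ∀ q k → W M q (suc k) ≡ W (delete M) q (suc k) ℚ.+ W (contract M e≡1) q k
  W-step q = conv-step (binom q) (cong fromℤ (coefs-zero M e≡1))
    (λ i → trans (cong fromℤ (coefs-suc M e≡1 i)) (fromℤ-+ (coefs (delete M) (suc i)) (coefs (contract M e≡1) i)))

  W-coloop : rank M ≡ suc (rank (delete M)) → ∀ q k → W M q (suc k) ≡ W (delete M) (1ℤ ℤ.+ q) (suc k)
  W-coloop coloop q k = begin
    W M q (suc k)                                     ≡⟨ W-step q k ⟩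
    W (delete M) q (suc k) ℚ.+ W (contract M e≡1) q k
      ≡⟨ cong (W (delete M) q (suc k) ℚ.+_) (conv-congʳ (binom q) k (λ i → cong fromℤ
           (whitney-cong m (coloop-in≡suc-out M e≡1 coloop) i))) ⟩
    W (delete M) q (suc k) ℚ.+ W (delete M) q k       ≡⟨ conv-pascal q (fromℤ ∘ coefs (delete M)) k ⟨
    W (delete M) (1ℤ ℤ.+ q) (suc k)                   ∎
    where open ≡-Reasoning

binom-pascal′ : ∀ n q k → binom (+ suc n ℤ.+ q) (suc k) ≡ binom (+ n ℤ.+ q) (suc k) ℚ.+ binom (+ n ℤ.+ q) k
binom-pascal′ n q k = trans (cong (λ α → binom α (suc k)) (ℤ.+-assoc 1ℤ (+ n) q)) (binom-pascal (+ n ℤ.+ q) k)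

suc-+ : ∀ n q → + suc n ℤ.+ q ≡ + n ℤ.+ (1ℤ ℤ.+ q)
suc-+ n q = lem (+ n) q
  where
  lem : ∀ ν q → (1ℤ ℤ.+ ν) ℤ.+ q ≡ ν ℤ.+ (1ℤ ℤ.+ q)
  lem = solve-∀

rank≤size : ∀ {m} (M : Matroid m) → rank M ℕ.≤ m
rank≤size {m} M = subst (rank M ℕ.≤_) (∣⊤∣≡n m) (Matroid.rk-bounded M ⊤)

-- The induction is on m with q arbitrary, because the coloop case changes q.
W-bounds : ∀ {m} (M : Matroid m) → Loopless M → ∀ q k → + k ℤ.≤ (+ rank M ℤ.+ q) ℤ.+ 1ℤ →
           (binom (+ rank M ℤ.+ q) k ℚ.≤ W M q k) × (W M q k ℚ.≤ binom (+ m ℤ.+ q) k)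
W-bounds M ll q zero _ = ℚ.≤-reflexive (sym (W-0≡1 M ll q)) , ℚ.≤-reflexive (W-0≡1 M ll q)
W-bounds {zero} M ll q (suc k) _ =
    ℚ.≤-reflexive (trans (cong (λ n → binom (+ n ℤ.+ q) (suc k)) (ℕ.n≤0⇒n≡0 (rank≤size M))) W≡)
  , ℚ.≤-reflexive (sym W≡)
  where
  W≡ : binom (0ℤ ℤ.+ q) (suc k) ≡ W M q (suc k)
  W≡ = trans (cong (λ α → binom α (suc k)) (ℤ.+-identityˡ q)) (sym (W-empty M q (suc k)))
W-bounds {suc m} M ll q (suc k) h with nonloop-rk≡1 M (ll zero)
... | e≡1 with rank-cases M e≡1
-- Rank and size drop by 1 while q rises by 1, so r + q, m + q and the condition on k are all
-- preserved.
... | inj₂ coloop = lower , upper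
  where
  D = delete M
  α≡ : + rank M ℤ.+ q ≡ + rank D ℤ.+ (1ℤ ℤ.+ q)
  α≡ = trans (cong (λ n → + n ℤ.+ q) coloop) (suc-+ (rank D) q)
  ih = W-bounds D (ll ∘ suc) (1ℤ ℤ.+ q) (suc k) (subst (λ α → + suc k ℤ.≤ α ℤ.+ 1ℤ) α≡ h)
  lower : binom (+ rank M ℤ.+ q) (suc k) ℚ.≤ W M q (suc k)
  lower = subst₂ ℚ._≤_ (cong (λ α → binom α (suc k)) (sym α≡)) (sym (W-coloop M e≡1 coloop q k)) (proj₁ ih)
  upper : W M q (suc k) ℚ.≤ binom (+ suc m ℤ.+ q) (suc k)
  upper = subst₂ ℚ._≤_ (sym (W-coloop M e≡1 coloop q k)) (cong (λ α → binom α (suc k)) (sym (suc-+ m q))) (proj₂ ih)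
-- The deletion keeps the rank; for the contraction the rank and k both drop by 1. The condition on
-- k thus passes to both.
... | inj₁ rank≡ = lower , upper
  where
  D = delete M
  K = contract M e≡1
  h′ : + k ℤ.≤ (+ rank K ℤ.+ q) ℤ.+ 1ℤ
  h′ = +-cancelˡ-≤ 1ℤ (subst (+ suc k ℤ.≤_)
    (trans (cong (λ n → + n ℤ.+ q ℤ.+ 1ℤ) (sym (rank-contract M e≡1))) (lem (+ rank K) q)) h)
    where
    lem : ∀ ν q → (1ℤ ℤ.+ ν) ℤ.+ q ℤ.+ 1ℤ ≡ 1ℤ ℤ.+ (ν ℤ.+ q ℤ.+ 1ℤ)
    lem = solve-∀
  ihD = W-bounds D (ll ∘ suc) q (suc k) (subst (λ n → + suc k ℤ.≤ (+ n ℤ.+ q) ℤ.+ 1ℤ) rank≡ h)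
  -- From below, 0 is enough: the deletion has the rank of M and already yields the whole lower
  -- bound.
  K-bounds : (0ℚ ℚ.≤ W K q k) × (W K q k ℚ.≤ binom (+ m ℤ.+ q) k)
  K-bounds with loop-dichotomy K
  ... | inj₁ ll′ = ℚ.≤-trans (binom-nonneg (+ rank K ℤ.+ q) k h′) (proj₁ ih) , proj₂ ih
    where ih = W-bounds K ll′ q k h′
  -- With loops the upper bound says that the binomial is nonnegative, which follows from `h′` and
  -- rank K ≤ m.
  ... | inj₂ W≡0 = ℚ.≤-reflexive (sym (W≡0 q k)) , subst (ℚ._≤ binom (+ m ℤ.+ q) k) (sym (W≡0 q k))
    (binom-nonneg (+ m ℤ.+ q) k (ℤ.≤-trans h′ (ℤ.+-monoˡ-≤ 1ℤ (ℤ.+-monoˡ-≤ q (+≤+ (rank≤size K))))))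
  lower : binom (+ rank M ℤ.+ q) (suc k) ℚ.≤ W M q (suc k)
  lower = subst₂ ℚ._≤_
    (trans (ℚ.+-identityʳ _) (cong (λ n → binom (+ n ℤ.+ q) (suc k)) (sym rank≡)))
    (sym (W-step M e≡1 q k))
    (ℚ.+-mono-≤ (proj₁ ihD) (proj₁ K-bounds))
  upper : W M q (suc k) ℚ.≤ binom (+ suc m ℤ.+ q) (suc k)
  upper = subst₂ ℚ._≤_ (sym (W-step M e≡1 q k)) (sym (binom-pascal′ m q k))
    (ℚ.+-mono-≤ (proj₂ ihD) (proj₂ K-bounds))

-- Identification with the coefficients of χ.

coeff-+ₚ : ∀ p q n → coeff (p +ₚ q) n ≡ coeff p n ℤ.+ coeff q n
coeff-+ₚ []       q        n       = sym (ℤ.+-identityˡ _)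
coeff-+ₚ (c ∷ p)  []       n       = sym (ℤ.+-identityʳ _)
coeff-+ₚ (c ∷ p)  (d ∷ q)  zero    = refl
coeff-+ₚ (c ∷ p)  (d ∷ q)  (suc n) = coeff-+ₚ p q n

coeff-·t^-≡ : ∀ c n → coeff (c ·t^ n) n ≡ c
coeff-·t^-≡ c zero    = refl
coeff-·t^-≡ c (suc n) = coeff-·t^-≡ c n

coeff-·t^-≢ : ∀ c n j → n ≢ j → coeff (c ·t^ n) j ≡ 0ℤ
coeff-·t^-≢ c zero    zero    n≢j = contradiction refl n≢j
coeff-·t^-≢ c zero    (suc j) n≢j = refl
coeff-·t^-≢ c (suc n) zero    n≢j = refl
coeff-·t^-≢ c (suc n) (suc j) n≢j = coeff-·t^-≢ c n j (n≢j ∘ cong suc)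

δ-≡ : ∀ n → δ n n ≡ -1ℤ ℤ.^ n
δ-≡ zero    = refl
δ-≡ (suc n) = trans (cong ℤ.-_ (δ-≡ n)) (sym (ℤ.-1*i≡-i (-1ℤ ℤ.^ n)))

δ-≢ : ∀ n i → n ≢ i → δ n i ≡ 0ℤ
δ-≢ zero    zero    n≢i = contradiction refl n≢i
δ-≢ zero    (suc i) n≢i = refl
δ-≢ (suc n) zero    n≢i = refl
δ-≢ (suc n) (suc i) n≢i = cong ℤ.-_ (δ-≢ n i (n≢i ∘ cong suc))

-- Recursion on the first element matches both the list `subsets m` and `whitney`.
∑ : ∀ m → (Subset m → ℤ) → ℤ
∑ zero    f = f []
∑ (suc m) f = ∑ m (f ∘ (outside ∷_)) ℤ.+ ∑ m (f ∘ (inside ∷_))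

∑-cong : ∀ m {f g} → (∀ A → f A ≡ g A) → ∑ m f ≡ ∑ m g
∑-cong zero    h = h []
∑-cong (suc m) h = cong₂ ℤ._+_ (∑-cong m (h ∘ (outside ∷_))) (∑-cong m (h ∘ (inside ∷_)))

∑-*ˡ : ∀ m c f → c ℤ.* ∑ m f ≡ ∑ m (λ A → c ℤ.* f A)
∑-*ˡ zero    c f = refl
∑-*ˡ (suc m) c f = trans (ℤ.*-distribˡ-+ c (∑ m (f ∘ (outside ∷_))) (∑ m (f ∘ (inside ∷_))))
  (cong₂ ℤ._+_ (∑-*ˡ m c (f ∘ (outside ∷_))) (∑-*ˡ m c (f ∘ (inside ∷_))))

coeff-foldr-++ : ∀ ps qs n → coeff (foldr _+ₚ_ [] (ps ++ qs)) n
               ≡ coeff (foldr _+ₚ_ [] ps) n ℤ.+ coeff (foldr _+ₚ_ [] qs) n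
coeff-foldr-++ []       qs n = sym (ℤ.+-identityˡ _)
coeff-foldr-++ (p ∷ ps) qs n = begin
  coeff (p +ₚ foldr _+ₚ_ [] (ps ++ qs)) n         ≡⟨ coeff-+ₚ p _ n ⟩
  coeff p n ℤ.+ coeff (foldr _+ₚ_ [] (ps ++ qs)) n ≡⟨ cong (ℤ._+_ (coeff p n)) (coeff-foldr-++ ps qs n) ⟩
  coeff p n ℤ.+ (coeff (foldr _+ₚ_ [] ps) n ℤ.+ coeff (foldr _+ₚ_ [] qs) n)
    ≡⟨ ℤ.+-assoc (coeff p n) _ _ ⟨
  coeff p n ℤ.+ coeff (foldr _+ₚ_ [] ps) n ℤ.+ coeff (foldr _+ₚ_ [] qs) n
    ≡⟨ cong (ℤ._+ coeff (foldr _+ₚ_ [] qs) n) (coeff-+ₚ p _ n) ⟨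
  coeff (p +ₚ foldr _+ₚ_ [] ps) n ℤ.+ coeff (foldr _+ₚ_ [] qs) n ∎
  where open ≡-Reasoning

coeff-subsets : ∀ m (t : Subset m → Poly) n →
  coeff (foldr _+ₚ_ [] (map t (subsets m))) n ≡ ∑ m (λ A → coeff (t A) n)
coeff-subsets zero    t n = trans (coeff-+ₚ (t []) [] n) (ℤ.+-identityʳ _)
coeff-subsets (suc m) t n = begin
  coeff (sumₚ (map t (map (outside ∷_) (subsets m) ++ map (inside ∷_) (subsets m)))) n
    ≡⟨ cong (λ ps → coeff (sumₚ ps) n) (map-++ t (map (outside ∷_) (subsets m)) (map (inside ∷_) (subsets m))) ⟩
  coeff (sumₚ (map t (map (outside ∷_) (subsets m)) ++ map t (map (inside ∷_) (subsets m)))) n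
    ≡⟨ coeff-foldr-++ (map t (map (outside ∷_) (subsets m))) (map t (map (inside ∷_) (subsets m))) n ⟩
  coeff (sumₚ (map t (map (outside ∷_) (subsets m)))) n ℤ.+ coeff (sumₚ (map t (map (inside ∷_) (subsets m)))) n
    ≡⟨ cong₂ ℤ._+_ (half outside) (half inside) ⟩
  ∑ (suc m) (λ A → coeff (t A) n) ∎
  where
  open ≡-Reasoning
  sumₚ : List Poly → Poly
  sumₚ = foldr _+ₚ_ []
  half : ∀ s → coeff (sumₚ (map t (map (s ∷_) (subsets m)))) n ≡ ∑ m (λ A → coeff (t (s ∷ A)) n)
  half s = trans (cong (λ ps → coeff (sumₚ ps) n) (sym (map-∘ (subsets m)))) (coeff-subsets m (t ∘ (s ∷_)) n)

-- Each subtraction in `whitney` stands for one element of A, so the signs multiply to (-1)^|A|.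
whitney-∑ : ∀ m ρ i → whitney m ρ i ≡ ∑ m (λ A → (-1ℤ ℤ.^ ∣ A ∣) ℤ.* δ (ρ A) i)
whitney-∑ zero    ρ i = sym (ℤ.*-identityˡ _)
whitney-∑ (suc m) ρ i = cong₂ ℤ._+_ (whitney-∑ m (ρ ∘ (outside ∷_)) i) (begin
  ℤ.- whitney m (ρ ∘ (inside ∷_)) i  ≡⟨ ℤ.-1*i≡-i _ ⟨
  -1ℤ ℤ.* whitney m (ρ ∘ (inside ∷_)) i  ≡⟨ cong (-1ℤ ℤ.*_) (whitney-∑ m (ρ ∘ (inside ∷_)) i) ⟩
  -1ℤ ℤ.* ∑ m (λ A → (-1ℤ ℤ.^ ∣ A ∣) ℤ.* δ (ρ (inside ∷ A)) i) ≡⟨ ∑-*ˡ m -1ℤ _ ⟩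
  ∑ m (λ A → -1ℤ ℤ.* ((-1ℤ ℤ.^ ∣ A ∣) ℤ.* δ (ρ (inside ∷ A)) i))
    ≡⟨ ∑-cong m (λ A → sym (ℤ.*-assoc -1ℤ (-1ℤ ℤ.^ ∣ A ∣) (δ (ρ (inside ∷ A)) i))) ⟩
  ∑ m (λ A → -1ℤ ℤ.* (-1ℤ ℤ.^ ∣ A ∣) ℤ.* δ (ρ (inside ∷ A)) i) ∎)
  where open ≡-Reasoning

whitney-vanishes : ∀ m ρ i → (∀ A → ρ A ℕ.< i) → whitney m ρ i ≡ 0ℤ
whitney-vanishes zero    ρ i h = δ-≢ (ρ []) i (ℕ.<⇒≢ (h []))
whitney-vanishes (suc m) ρ i h =
  cong₂ ℤ._-_ (whitney-vanishes m _ i (h ∘ (outside ∷_))) (whitney-vanishes m _ i (h ∘ (inside ∷_)))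

-- Since rk(A) and i are at most r, the exponents r - rk(A) and r - i agree exactly when rk(A) = i;
-- the sign (-1)ⁱ in `a` is then the one in `δ`.
a≡coefs : ∀ {m} (M : Matroid m) i → a M i ≡ coefs M i
a≡coefs {m} M i with i ℕ.≤ᵇ rank M in eq
-- For i > r no subset has rank i, which matches the default value 0 of `a`.
... | false = sym (whitney-vanishes m rk i (λ A → ℕ.≤-<-trans (rk-monotone (⊆-max A)) (ℕ.≰⇒> (λ i≤r → subst T eq (ℕ.≤⇒≤ᵇ i≤r)))))
  where open Matroid M using (rk; rk-monotone)
... | true = begin
  (-1ℤ ℤ.^ i) ℤ.* coeff (χ M) (rank M ∸ i)
    ≡⟨ cong ((-1ℤ ℤ.^ i) ℤ.*_) (coeff-subsets m (λ A → (-1ℤ ℤ.^ ∣ A ∣) ·t^ (rk ⊤ ∸ rk A)) (rank M ∸ i)) ⟩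
  (-1ℤ ℤ.^ i) ℤ.* ∑ m (λ A → coeff ((-1ℤ ℤ.^ ∣ A ∣) ·t^ (rk ⊤ ∸ rk A)) (rank M ∸ i))
    ≡⟨ ∑-*ˡ m (-1ℤ ℤ.^ i) _ ⟩
  ∑ m (λ A → (-1ℤ ℤ.^ i) ℤ.* coeff ((-1ℤ ℤ.^ ∣ A ∣) ·t^ (rk ⊤ ∸ rk A)) (rank M ∸ i))
    ≡⟨ ∑-cong m term ⟩
  ∑ m (λ A → (-1ℤ ℤ.^ ∣ A ∣) ℤ.* δ (rk A) i)
    ≡⟨ whitney-∑ m rk i ⟨
  whitney m rk i ∎
  where
  open ≡-Reasoning
  open Matroid M using (rk; rk-monotone)
  i≤r : i ℕ.≤ rank M
  i≤r = ℕ.≤ᵇ⇒≤ i (rank M) (subst T (sym eq) _)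
  term : ∀ A → (-1ℤ ℤ.^ i) ℤ.* coeff ((-1ℤ ℤ.^ ∣ A ∣) ·t^ (rk ⊤ ∸ rk A)) (rank M ∸ i)
             ≡ (-1ℤ ℤ.^ ∣ A ∣) ℤ.* δ (rk A) i
  term A with rk A ℕ.≟ i
  ... | yes refl = begin
    (-1ℤ ℤ.^ rk A) ℤ.* coeff ((-1ℤ ℤ.^ ∣ A ∣) ·t^ (rk ⊤ ∸ rk A)) (rank M ∸ rk A)
      ≡⟨ cong ((-1ℤ ℤ.^ rk A) ℤ.*_) (coeff-·t^-≡ (-1ℤ ℤ.^ ∣ A ∣) (rk ⊤ ∸ rk A)) ⟩
    (-1ℤ ℤ.^ rk A) ℤ.* (-1ℤ ℤ.^ ∣ A ∣)  ≡⟨ ℤ.*-comm (-1ℤ ℤ.^ rk A) (-1ℤ ℤ.^ ∣ A ∣) ⟩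
    (-1ℤ ℤ.^ ∣ A ∣) ℤ.* (-1ℤ ℤ.^ rk A)  ≡⟨ cong ((-1ℤ ℤ.^ ∣ A ∣) ℤ.*_) (δ-≡ (rk A)) ⟨
    (-1ℤ ℤ.^ ∣ A ∣) ℤ.* δ (rk A) (rk A) ∎
  ... | no rk≢i = trans
    (trans (cong ((-1ℤ ℤ.^ i) ℤ.*_) (coeff-·t^-≢ _ _ _ (rk≢i ∘ ℕ.∸-cancelˡ-≡ (rk-monotone (⊆-max A)) i≤r)))
           (ℤ.*-zeroʳ (-1ℤ ℤ.^ i)))
    (sym (trans (cong ((-1ℤ ℤ.^ ∣ A ∣) ℤ.*_) (δ-≢ (rk A) i rk≢i)) (ℤ.*-zeroʳ (-1ℤ ℤ.^ ∣ A ∣))))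

-- Signs and the special values of q.

-1^-∸ : ∀ {i k} → i ℕ.≤ k → -1ℤ ℤ.^ (k ∸ i) ≡ (-1ℤ ℤ.^ k) ℤ.* (-1ℤ ℤ.^ i)
-1^-∸ {k = k} z≤n = sym (ℤ.*-identityʳ (-1ℤ ℤ.^ k))
-1^-∸ {suc i} {suc k} (s≤s i≤k) = trans (-1^-∸ i≤k) (lem (-1ℤ ℤ.^ k) (-1ℤ ℤ.^ i))
  where
  lem : ∀ x y → x ℤ.* y ≡ (ℤ.- 1ℤ ℤ.* x) ℤ.* (ℤ.- 1ℤ ℤ.* y)
  lem = solve-∀

theorem3p1 : ∀ (m : ℕ) (M : Matroid m) → Loopless M →
    let r = rank M in
    (∀ (q : ℤ) (k : ℕ) → + k ℤ.≤ q ℤ.+ + r ℤ.+ 1ℤ →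
    (binom (+ r ℤ.+ q) k ℚ.≤ Σ₀ k (λ i → binom q (k ∸ i) ℚ.* fromℤ (a M i)))
    × (Σ₀ k (λ i → binom q (k ∸ i) ℚ.* fromℤ (a M i)) ℚ.≤ binom (+ m ℤ.+ q) k))
    × (∀ (k : ℕ) → k ℕ.≤ r →
    (binom (+ r ℤ.- 1ℤ) k ℚ.≤ fromℤ (-1ℤ ℤ.^ k) ℚ.* Σ₀ k (λ i → fromℤ ((-1ℤ ℤ.^ i) ℤ.* a M i)))
    × (fromℤ (-1ℤ ℤ.^ k) ℚ.* Σ₀ k (λ i → fromℤ ((-1ℤ ℤ.^ i) ℤ.* a M i)) ℚ.≤ binom (+ m ℤ.- 1ℤ) k))
    × (∀ (k : ℕ) → k ℕ.≤ r →
    fromℤ (-1ℤ ℤ.^ k) ℚ.* Σ₀ k (λ i → binom (+ r ℤ.- + i) (k ∸ i) ℚ.* fromℤ ((-1ℤ ℤ.^ i) ℤ.* a M i)) ℚ.≥ 0ℚ)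
theorem3p1 m M ll = general , alternating , nonneg
  where
  r = rank M

  S : ℤ → ℕ → ℚ
  S q = conv (binom q) (fromℤ ∘ a M)

  general : ∀ q k → + k ℤ.≤ q ℤ.+ + r ℤ.+ 1ℤ →
            (binom (+ r ℤ.+ q) k ℚ.≤ S q k) × (S q k ℚ.≤ binom (+ m ℤ.+ q) k)
  general q k h = subst (λ x → (binom (+ r ℤ.+ q) k ℚ.≤ x) × (x ℚ.≤ binom (+ m ℤ.+ q) k))
    (conv-congʳ (binom q) k (cong fromℤ ∘ sym ∘ a≡coefs M))
    (W-bounds M ll q k (subst (λ α → + k ℤ.≤ α ℤ.+ 1ℤ) (ℤ.+-comm q (+ r)) h))

  -- Merges (-1)ᵏ and (-1)ⁱ into (-1)^(k - i), the sign that `binom--1` and `binom-reflect` turn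
  -- into a binomial coefficient in q.
  signs : ∀ k (b : ℕ → ℚ) → fromℤ (-1ℤ ℤ.^ k) ℚ.* Σ₀ k (λ i → b i ℚ.* fromℤ ((-1ℤ ℤ.^ i) ℤ.* a M i))
        ≡ Σ₀ k (λ i → fromℤ (-1ℤ ℤ.^ (k ∸ i)) ℚ.* b i ℚ.* fromℤ (a M i))
  signs k b = trans (Σ₀-*ˡ k (fromℤ (-1ℤ ℤ.^ k)) (λ i → b i ℚ.* fromℤ ((-1ℤ ℤ.^ i) ℤ.* a M i)))
    (Σ₀-cong k λ i i≤k → begin
      fromℤ (-1ℤ ℤ.^ k) ℚ.* (b i ℚ.* fromℤ ((-1ℤ ℤ.^ i) ℤ.* a M i))
        ≡⟨ cong (λ x → fromℤ (-1ℤ ℤ.^ k) ℚ.* (b i ℚ.* x)) (fromℤ-* (-1ℤ ℤ.^ i) (a M i)) ⟩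
      fromℤ (-1ℤ ℤ.^ k) ℚ.* (b i ℚ.* (fromℤ (-1ℤ ℤ.^ i) ℚ.* fromℤ (a M i)))
        ≡⟨ lem (fromℤ (-1ℤ ℤ.^ k)) (b i) (fromℤ (-1ℤ ℤ.^ i)) (fromℤ (a M i)) ⟩
      fromℤ (-1ℤ ℤ.^ k) ℚ.* fromℤ (-1ℤ ℤ.^ i) ℚ.* b i ℚ.* fromℤ (a M i)
        ≡⟨ cong (λ x → x ℚ.* b i ℚ.* fromℤ (a M i))
             (trans (sym (fromℤ-* (-1ℤ ℤ.^ k) (-1ℤ ℤ.^ i))) (cong fromℤ (sym (-1^-∸ i≤k)))) ⟩
      fromℤ (-1ℤ ℤ.^ (k ∸ i)) ℚ.* b i ℚ.* fromℤ (a M i) ∎)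
    where
    open ≡-Reasoning
    open ℚS using (_:=_; _:*_)
    lem : ∀ s b t x → s ℚ.* (b ℚ.* (t ℚ.* x)) ≡ s ℚ.* t ℚ.* b ℚ.* x
    lem = ℚS.solve 4 (λ s b t x → s :* (b :* (t :* x)) := s :* t :* b :* x) refl

  alternating : ∀ k → k ℕ.≤ r →
    (binom (+ r ℤ.- 1ℤ) k ℚ.≤ fromℤ (-1ℤ ℤ.^ k) ℚ.* Σ₀ k (λ i → fromℤ ((-1ℤ ℤ.^ i) ℤ.* a M i)))
    × (fromℤ (-1ℤ ℤ.^ k) ℚ.* Σ₀ k (λ i → fromℤ ((-1ℤ ℤ.^ i) ℤ.* a M i)) ℚ.≤ binom (+ m ℤ.- 1ℤ) k)
  alternating k k≤r = subst (λ x → (binom (+ r ℤ.- 1ℤ) k ℚ.≤ x) × (x ℚ.≤ binom (+ m ℤ.- 1ℤ) k))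
    (sym (begin
      fromℤ (-1ℤ ℤ.^ k) ℚ.* Σ₀ k (λ i → fromℤ ((-1ℤ ℤ.^ i) ℤ.* a M i))
        ≡⟨ cong (fromℤ (-1ℤ ℤ.^ k) ℚ.*_) (Σ₀-cong k (λ i _ → sym (ℚ.*-identityˡ _))) ⟩
      fromℤ (-1ℤ ℤ.^ k) ℚ.* Σ₀ k (λ i → 1ℚ ℚ.* fromℤ ((-1ℤ ℤ.^ i) ℤ.* a M i))
        ≡⟨ signs k (λ _ → 1ℚ) ⟩
      Σ₀ k (λ i → fromℤ (-1ℤ ℤ.^ (k ∸ i)) ℚ.* 1ℚ ℚ.* fromℤ (a M i))
        ≡⟨ Σ₀-cong k (λ i _ → cong (ℚ._* fromℤ (a M i))
             (trans (ℚ.*-identityʳ _) (sym (binom--1 (k ∸ i))))) ⟩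
      S -1ℤ k ∎))
    -- At q = -1 the condition k ≤ q + r + 1 reads k ≤ r.
    (general -1ℤ k (ℤ.≤-trans (+≤+ k≤r) (ℤ.≤-reflexive (lem (+ r)))))
    where
    open ≡-Reasoning
    lem : ∀ ρ → ρ ≡ ℤ.- 1ℤ ℤ.+ ρ ℤ.+ 1ℤ
    lem = solve-∀

  nonneg : ∀ k → k ℕ.≤ r →
    0ℚ ℚ.≤ fromℤ (-1ℤ ℤ.^ k) ℚ.* Σ₀ k (λ i → binom (+ r ℤ.- + i) (k ∸ i) ℚ.* fromℤ ((-1ℤ ℤ.^ i) ℤ.* a M i))
  nonneg k _ = subst (0ℚ ℚ.≤_)
    (sym (trans (signs k (λ i → binom (+ r ℤ.- + i) (k ∸ i)))
      (Σ₀-cong k (λ i i≤k → cong (ℚ._* fromℤ (a M i)) (sym (reflect i i≤k))))))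
    -- Here r + q = k - 1, so the lower bound is `binom` of k - 1 at k, the extreme case of
    -- `binom-nonneg`.
    (ℚ.≤-trans (binom-nonneg (+ r ℤ.+ q) k (ℤ.≤-reflexive (lem₁ (+ k) (+ r))))
               (proj₁ (general q k (ℤ.≤-reflexive (lem₂ (+ k) (+ r))))))
    where
    -- Chosen so that q = (k - i) - (r - i) - 1 for every i, the form that `binom-reflect` requires.
    q = + k ℤ.- + r ℤ.- 1ℤ
    lem₁ : ∀ κ ρ → κ ≡ ρ ℤ.+ (κ ℤ.- ρ ℤ.- 1ℤ) ℤ.+ 1ℤ
    lem₁ = solve-∀
    lem₂ : ∀ κ ρ → κ ≡ (κ ℤ.- ρ ℤ.- 1ℤ) ℤ.+ ρ ℤ.+ 1ℤ
    lem₂ = solve-∀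
    lem₃ : ∀ κ ι ρ → κ ℤ.- ρ ℤ.- 1ℤ ≡ (κ ℤ.- ι) ℤ.- (ρ ℤ.- ι) ℤ.- 1ℤ
    lem₃ = solve-∀
    reflect : ∀ i → i ℕ.≤ k → binom q (k ∸ i) ≡ fromℤ (-1ℤ ℤ.^ (k ∸ i)) ℚ.* binom (+ r ℤ.- + i) (k ∸ i)
    reflect i i≤k = trans
      (cong (λ α → binom α (k ∸ i)) (trans (lem₃ (+ k) (+ i) (+ r))
        (cong (λ κ → κ ℤ.- (+ r ℤ.- + i) ℤ.- 1ℤ) (trans (ℤ.m-n≡m⊖n k i) (ℤ.⊖-≥ i≤k)))))
      (binom-reflect (+ r ℤ.- + i) (k ∸ i))
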